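{- For all integers $s,t$ with $3\leq s\leq t$, the complete bipartite graph $K_{s,t}$ satisfies $rx_3(K_{s,t})\leq \min\{6,\,s+t-3\}$. Moreover, the bound is tight: there exist integers $3\le s\le t$ with $rx_3(K_{s,t})= \min\{6,\,s+t-3\}$.
   Context: Graphs are finite, simple and undirected. Edge colorings are arbitrary (adjacent edges may receive the same color). In an edge-colored graph $G$, a tree $T\subseteq G$ (a subgraph that is a tree) is a rainbow tree if no two edges of $T$ have the same color. For a connected graph $G$ of order $n\ge 3$, a $3$-rainbow coloring of $G$ is an edge coloring such that for every set $S$ of $3$ vertices of $G$ there is a rainbow tree $T$ in $G$ with $S\subseteq V(T)$. The $3$-rainbow index $rx_3(G)$ is the minimum number of colors in a $3$-rainbow coloring of $G$. -}

module Defs where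

open import Data.Fin.Base using (Fin)
open import Data.Fin.Properties using (+↔⊎)
open import Data.List.Base using (List; head; last; length)
open import Data.List.Relation.Unary.Linked using (Linked)
open import Data.List.Relation.Unary.Unique.Propositional using (Unique)
open import Data.Maybe.Base using (just)
open import Data.Nat.Base using (ℕ; _+_; _≤_)
open import Data.Product.Base using (Σ-syntax; ∃-syntax; _×_)
open import Data.Sum.Base using (_⊎_; inj₁; inj₂)
open import Function.Bundles using (_↔_)
open import Function.Construct.Symmetry using (↔-sym)
open import Level using (0ℓ)
open import Relation.Binary.Core using (Rel)
open import Relation.Binary.Definitions as B using (Symmetric; Irreflexive)
open import Relation.Binary.PropositionalEquality.Core using (_≡_; _≢_)
open import Relation.Nullary.Decidable.Core using (yes; no)
open import Relation.Nullary.Negation.Core using (¬_)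
open import Relation.Unary as U using (Pred)

record Graph : Set₁ where
  field
    V        : Set
    order    : ℕ
    V↔Fin    : V ↔ Fin order
    _~_      : Rel V 0ℓ
    _~?_     : B.Decidable _~_
    ~-sym    : Symmetric _~_
    ~-irrefl : Irreflexive _≡_ _~_

record Subgraph (G : Graph) : Set₁ where
  open Graph G
  field
    Vertex  : Pred V 0ℓ
    vertex? : U.Decidable Vertex
    Edge    : Rel V 0ℓ
    edge?   : B.Decidable Edge
    edge-sym : Symmetric Edge
    edge⇒~  : ∀ {u v} → Edge u v → u ~ v
    -- The other endpoint follows from edge-sym.
    source∈ : ∀ {u v} → Edge u v → Vertex u

module _ {G : Graph} (H : Subgraph G) where
  open Graph G
  open Subgraph H

  -- A path is its list of vertices, which are pairwise distinct. The
  -- one-vertex list [ u ] is a path from u to u whether or not u lies in H,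
  -- so membership of the ends has to be required where IsPath is used.
  record IsPath (u v : V) (xs : List V) : Set where
    field
      starts : head xs ≡ just u
      ends   : last xs ≡ just v
      linked : Linked Edge xs
      unique : Unique xs

  Connected : Set
  Connected = ∀ {u v} → Vertex u → Vertex v → ∃[ xs ] IsPath u v xs

  -- A cycle is a path on at least three vertices whose ends are joined by an
  -- edge.
  record IsCycle (u v : V) (xs : List V) : Set where
    field
      path   : IsPath u v xs
      long   : 3 ≤ length xs
      closes : Edge v u

  Acyclic : Set
  Acyclic = ∀ {u v xs} → ¬ IsCycle u v xs

  record IsTree : Set where
    field
      nonempty  : ∃[ v ] Vertex v
      connected : Connected
      acyclic   : Acyclic

record EdgeColoring (G : Graph) (k : ℕ) : Set where
  open Graph G
  field
    color     : ∀ {u v} → u ~ v → Fin k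
    -- Applied twice, this also makes the color independent of the proof of
    -- adjacency.
    color-sym : ∀ {u v} (p : u ~ v) (q : v ~ u) → color p ≡ color q

module _ {G : Graph} {k : ℕ} (c : EdgeColoring G k) where
  open Graph G
  open EdgeColoring c
  open Subgraph

  -- Edges with equal colors are equal as unordered pairs.
  Rainbow : Subgraph G → Set
  Rainbow H = ∀ {a b a′ b′} (e : Edge H a b) (e′ : Edge H a′ b′) →
    color (edge⇒~ H e) ≡ color (edge⇒~ H e′) →
    (a ≡ a′ × b ≡ b′) ⊎ (a ≡ b′ × b ≡ a′)

  IsRainbow₃ : Set₁
  IsRainbow₃ = ∀ x y z → x ≢ y → x ≢ z → y ≢ z →
    Σ[ T ∈ Subgraph G ]
      IsTree T × Rainbow T × Vertex T x × Vertex T y × Vertex T z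

Rainbow₃Colorable : Graph → ℕ → Set₁
Rainbow₃Colorable G k = Σ[ c ∈ EdgeColoring G k ] IsRainbow₃ c

-- IsRx₃ G r says that rx₃(G) = r. Colors are drawn from a palette of size k,
-- not all of which need be used; this does not affect the minimum.
record IsRx₃ (G : Graph) (r : ℕ) : Set₁ where
  field
    colorable : Rainbow₃Colorable G r
    minimal   : ∀ k → Rainbow₃Colorable G k → r ≤ k

data BipartiteAdj {s t : ℕ} : Rel (Fin s ⊎ Fin t) 0ℓ where
  left-right : ∀ {i j} → BipartiteAdj (inj₁ i) (inj₂ j)
  right-left : ∀ {i j} → BipartiteAdj (inj₂ j) (inj₁ i)

K : ℕ → ℕ → Graph
K s t = record
  { V        = Fin s ⊎ Fin t
  ; order    = s + t
  ; V↔Fin    = ↔-sym +↔⊎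
  ; _~_      = BipartiteAdj
  ; _~?_     = λ { (inj₁ _) (inj₁ _) → no λ ()
                 ; (inj₁ _) (inj₂ _) → yes left-right
                 ; (inj₂ _) (inj₁ _) → yes right-left
                 ; (inj₂ _) (inj₂ _) → no λ () }
  ; ~-sym    = λ { left-right → right-left ; right-left → left-right }
  ; ~-irrefl = λ { {inj₁ _} _≡_.refl () ; {inj₂ _} _≡_.refl () }
  }

{-# OPTIONS --safe #-}

-- Colour the edge l_i r_j with i + j modulo k = min {6, s + t − 3}; if k = 6,
-- the indices are first clipped to at most 3, which makes clones of all the
-- vertices of one side after its first three. Up to clones there are finitely
-- many triples, and a short list of rainbow trees spans each of them. That the
-- minimum rx₃ exists constructively is a matter of exhaustive search: colorings
-- and subgraphs are finite tables, and paths have at most as many vertices as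
-- the graph. The bound is attained at s = t = 3: in a tree containing three
-- vertices of one side, an edge at each of them gives three distinct edges.
module Submission where

open import Agda.Primitive using (Setω)
open import Data.Bool.Base using (Bool; true; false; T)
open import Data.Bool.Properties using (T?)
open import Data.Empty using (⊥)
open import Data.Fin.Base using (Fin; toℕ; _↑ˡ_; splitAt)
open import Data.Fin.Patterns using (0F; 1F; 2F; 3F; 4F)
import Data.Fin.Properties as Fin
open import Data.List.Base
  using (List; []; _∷_; [_]; _∷ʳ_; head; last; length; lookup; map; concatMap)
import Data.List.Membership.DecPropositional as Membership
open import Data.List.Membership.Propositional using (_∈_; _∉_)
open import Data.List.Membership.Propositional.Properties using (∈-lookup)
open import Data.List.Relation.Unary.All as All using (All; []; _∷_)
import Data.List.Relation.Unary.All.Properties as All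
open import Data.List.Relation.Unary.AllPairs using ([]; _∷_)
open import Data.List.Relation.Unary.Any as Any using (Any; here; there; any?)
import Data.List.Relation.Unary.Any.Properties as Any
open import Data.List.Relation.Unary.Linked as Linked using (Linked; []; [-]; _∷_)
import Data.List.Relation.Unary.Unique.DecPropositional as UniqueDec
open import Data.List.Relation.Unary.Unique.Propositional using (Unique)
open import Data.Maybe.Base using (Maybe; just; nothing)
import Data.Maybe.Properties as Maybe
open import Data.Maybe.Relation.Unary.Any as Maybe using (just)
open import Data.Nat.Base
  using (ℕ; zero; suc; _+_; _∸_; _≤_; _⊓_; z≤n; s≤s; NonZero)
open import Data.Nat.DivMod using (_mod_)
import Data.Nat.Properties as ℕ
open import Data.Product.Base as Product
  using (Σ-syntax; ∃; ∃-syntax; ∃₂; _×_; _,_; proj₁; proj₂; map₂)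
open import Data.Sum.Base as Sum using (_⊎_; inj₁; inj₂; [_,_]′)
import Data.Sum.Properties as Sum
open import Data.Unit.Base using (⊤; tt)
open import Data.Vec.Base as Vec using (Vec; []; _∷_)
open import Data.Vec.Properties using (lookup∘tabulate; lookup-map)
open import Function.Base using (_∘_; const; id)
open import Function.Bundles
  using (Inverse; Injection; _⇔_; mk⇔; Equivalence; _↔_)
open import Function.Construct.Identity using (⇔-id)
open import Function.Construct.Symmetry using (⇔-sym)
open import Function.Definitions using (Injective)
open import Function.Properties.Inverse using (↔⇒↣)
open import Level using (0ℓ)
open import Relation.Binary.Core using (Rel)
open import Relation.Binary.Definitions using (DecidableEquality; Symmetric)
open import Relation.Binary.PropositionalEquality
  using (_≡_; _≢_; refl; sym; trans; cong; cong₂; subst)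
open import Relation.Nullary.Decidable
  using (Dec; yes; no; True; isYes; toWitness; fromWitness; map′; via-injection;
         decidable-stable; ¬?; _×-dec_; _⊎-dec_; _→-dec_)
open import Relation.Nullary.Negation using (¬_; contradiction)
open import Relation.Unary using (Pred; Decidable)
open import Defs

-- Exhaustive search

private variable
  A B : Set

-- Polymorphic in the level of `P`, and hence in `Setω`, because predicates such as `IsRainbow₃`
-- live in `Set₁`.
Searchable : Set → Setω
Searchable A = ∀ {ℓ} {P : Pred A ℓ} → Decidable P → Dec (∃ P)

for-all? : Searchable A → ∀ {ℓ} {P : Pred A ℓ} → Decidable P → Dec (∀ a → P a)
for-all? search P? = map′
  (λ ∄¬P a → decidable-stable (P? a) λ ¬p → ∄¬P (a , ¬p))
  (λ { p (a , ¬p) → ¬p (p a) })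
  (¬? (search (¬? ∘ P?)))

search-↔ : A ↔ B → Searchable B → Searchable A
search-↔ A↔B search {P = P} P? = map′
  (λ { (b , p) → from b , p })
  (λ { (a , p) → to a , subst P (sym (strictlyInverseʳ a)) p })
  (search (P? ∘ from))
  where open Inverse A↔B

search-× : Searchable A → Searchable B → Searchable (A × B)
search-× searchA searchB P? = map′
  (λ { (a , b , p) → (a , b) , p })
  (λ { ((a , b) , p) → a , b , p })
  (searchA λ a → searchB λ b → P? (a , b))

search-⊎ : Searchable A → Searchable B → Searchable (A ⊎ B)
search-⊎ searchA searchB P? = map′
  (λ { (inj₁ (a , p)) → inj₁ a , p ; (inj₂ (b , p)) → inj₂ b , p })
  (λ { (inj₁ a , p) → inj₁ (a , p) ; (inj₂ b , p) → inj₂ (b , p) })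
  (searchA (P? ∘ inj₁) ⊎-dec searchB (P? ∘ inj₂))

search-Bool : Searchable Bool
search-Bool P? = map′
  (λ { (inj₁ p) → false , p ; (inj₂ p) → true , p })
  (λ { (false , p) → inj₁ p ; (true , p) → inj₂ p })
  (P? false ⊎-dec P? true)

search-Vec : Searchable A → ∀ n → Searchable (Vec A n)
search-Vec search zero P? = map′ ([] ,_) (λ { ([] , p) → p }) (P? [])
search-Vec search (suc n) P? = map′
  (λ { (a , as , p) → a ∷ as , p })
  (λ { (a ∷ as , p) → a , as , p })
  (search λ a → search-Vec search n λ as → P? (a ∷ as))

search-List : Searchable A → ∀ n {ℓ} {P : Pred (List A) ℓ} → Decidable P →
  Dec (∃[ as ] (length as ≤ n × P as))
search-List search zero P? = map′
  (λ p → [] , z≤n , p) (λ { ([] , _ , p) → p }) (P? [])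
search-List search (suc n) P? = map′
  (λ { (inj₁ p) → [] , z≤n , p
     ; (inj₂ (a , as , ≤n , p)) → a ∷ as , s≤s ≤n , p })
  (λ { ([] , _ , p) → inj₁ p
     ; (a ∷ as , s≤s ≤n , p) → inj₂ (a , as , ≤n , p) })
  (P? [] ⊎-dec search λ a → search-List search n (P? ∘ (a ∷_)))

Unique⇒lookup-injective : {xs : List A} → Unique xs → Injective _≡_ _≡_ (lookup xs)
Unique⇒lookup-injective (_ ∷ _) {Fin.zero} {Fin.zero} _ = refl
Unique⇒lookup-injective {xs = _ ∷ xs} (x∉xs ∷ _) {Fin.zero} {Fin.suc j} eq =
  contradiction eq (All.lookup x∉xs (∈-lookup j))
Unique⇒lookup-injective {xs = _ ∷ xs} (x∉xs ∷ _) {Fin.suc i} {Fin.zero} eq =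
  contradiction (sym eq) (All.lookup x∉xs (∈-lookup i))
Unique⇒lookup-injective (_ ∷ u) {Fin.suc i} {Fin.suc j} eq =
  cong Fin.suc (Unique⇒lookup-injective u eq)

-- The known witness `n` bounds the recursion, which shifts `P` by one at each step. The component
-- `m ≤ n` later turns colorability with `k` colors into an upper bound for rx₃.
least : ∀ {ℓ} {P : Pred ℕ ℓ} → Decidable P → ∀ n → P n →
  ∃[ m ] (P m × (∀ k → P k → m ≤ k) × m ≤ n)
least P? zero p = 0 , p , (λ _ _ → z≤n) , z≤n
least {P = P} P? (suc n) p with P? 0
... | yes p₀ = 0 , p₀ , (λ _ _ → z≤n) , z≤n
... | no ¬p₀ with least (P? ∘ suc) n p
...   | m , pm , min , m≤n = suc m , pm , min′ , s≤s m≤n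
  where
  min′ : ∀ k → P k → suc m ≤ k
  min′ zero    p₀ = contradiction p₀ ¬p₀
  min′ (suc k) pk = s≤s (min k pk)

module _ (G : Graph) where
  open Graph G

  _≟ⱽ_ : DecidableEquality V
  _≟ⱽ_ = via-injection (↔⇒↣ V↔Fin) Fin._≟_

  search-V : Searchable V
  search-V = search-↔ V↔Fin Fin.any?

  -- Pigeonhole principle for the positions of `xs`; it makes the searches for paths and cycles
  -- finite.
  Unique⇒length≤order : {xs : List V} → Unique xs → length xs ≤ order
  Unique⇒length≤order unique = Fin.injective⇒≤ λ eq →
    Unique⇒lookup-injective unique (Injection.injective (↔⇒↣ V↔Fin) eq)

-- Deciding whether a subgraph is a tree

module _ {G : Graph} (H : Subgraph G) where
  open Graph G
  open Subgraph H

  isPath? : ∀ u v xs → Dec (IsPath H u v xs)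
  isPath? u v xs = map′
    (λ { (s , e , l , q) → record { starts = s ; ends = e ; linked = l ; unique = q } })
    (λ p → let open IsPath p in starts , ends , linked , unique)
    (head xs ≟ᴹ just u ×-dec last xs ≟ᴹ just v ×-dec
     Linked.linked? edge? xs ×-dec UniqueDec.unique? (_≟ⱽ_ G) xs)
    where _≟ᴹ_ = Maybe.≡-dec (_≟ⱽ_ G)

  isCycle? : ∀ u v xs → Dec (IsCycle H u v xs)
  isCycle? u v xs = map′
    (λ { (p , l , c) → record { path = p ; long = l ; closes = c } })
    (λ p → let open IsCycle p in path , long , closes)
    (isPath? u v xs ×-dec 3 ℕ.≤? length xs ×-dec edge? v u)

  connected? : Dec (Connected H)
  connected? = map′ (λ f → f _ _) (λ f u v → f)
    (for-all? (search-V G) λ u → for-all? (search-V G) λ v →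
      vertex? u →-dec vertex? v →-dec map′ (map₂ proj₂)
        (map₂ λ p → Unique⇒length≤order G (IsPath.unique p) , p)
        (search-List (search-V G) order (isPath? u v)))

  acyclic? : Dec (Acyclic H)
  acyclic? = map′ (λ f c → f _ _ (_ , c)) (λ f u v (_ , c) → f c)
    (for-all? (search-V G) λ u → for-all? (search-V G) λ v →
      ¬? (map′ (map₂ proj₂)
        (map₂ λ c → Unique⇒length≤order G (IsPath.unique (IsCycle.path c)) , c)
        (search-List (search-V G) order (isCycle? u v))))

  isTree? : Dec (IsTree H)
  isTree? = map′ to from (search-V G vertex? ×-dec connected? ×-dec acyclic?)
    where
    to : ∃ Vertex × Connected H × Acyclic H → IsTree H
    to (n , c , a) = record { nonempty = n ; connected = c ; acyclic = a }

    from : IsTree H → ∃ Vertex × Connected H × Acyclic H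
    from t = nonempty , connected , acyclic
      where open IsTree t

-- Extensional equality. A subgraph and its finite table have equivalent, but in general not
-- identical, predicates, so everything decided about tables is carried over along this relation.
record _≐_ {G : Graph} (H H′ : Subgraph G) : Set where
  open Subgraph
  field
    vertex⇔ : ∀ {v} → Vertex H v ⇔ Vertex H′ v
    edge⇔   : ∀ {u v} → Edge H u v ⇔ Edge H′ u v

  vertex→ : ∀ {v} → Vertex H v → Vertex H′ v
  vertex→ = Equivalence.to vertex⇔

  edge→ : ∀ {u v} → Edge H u v → Edge H′ u v
  edge→ = Equivalence.to edge⇔

  isPath→ : ∀ {u v xs} → IsPath H u v xs → IsPath H′ u v xs
  isPath→ p = record
    { starts = starts ; ends = ends ; linked = Linked.map edge→ linked ; unique = unique }
    where open IsPath p

open _≐_ using (vertex→; edge→; isPath→)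

≐-sym : {G : Graph} {H H′ : Subgraph G} → H ≐ H′ → H′ ≐ H
≐-sym H≐H′ = record { vertex⇔ = ⇔-sym vertex⇔ ; edge⇔ = ⇔-sym edge⇔ }
  where open _≐_ H≐H′

isTree-resp : {G : Graph} {H H′ : Subgraph G} → H ≐ H′ → IsTree H → IsTree H′
isTree-resp H≐H′ t = record
  { nonempty  = map₂ (vertex→ H≐H′) nonempty
  ; connected = λ u v → map₂ (isPath→ H≐H′) (connected (vertex→ H′≐H u) (vertex→ H′≐H v))
  ; acyclic   = λ c → let open IsCycle c in acyclic record
      { path = isPath→ H′≐H path ; long = long ; closes = edge→ H′≐H closes }
  }
  where
  open IsTree t
  H′≐H = ≐-sym H≐H′

module _ {G : Graph} {k : ℕ} (c : EdgeColoring G k) where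
  open Graph G
  open EdgeColoring c
  open Subgraph

  color-irrelevant : ∀ {u v} (p q : u ~ v) → color p ≡ color q
  color-irrelevant p q = trans (color-sym p (~-sym p)) (color-sym (~-sym p) q)

  rainbow? : ∀ H → Dec (Rainbow c H)
  rainbow? H = map′ (λ f → f _ _ _ _) (λ f _ _ _ _ → f)
    (for-all? (search-V G) λ a → for-all? (search-V G) λ b →
     for-all? (search-V G) λ a′ → for-all? (search-V G) λ b′ → pair? a b a′ b′)
    where
    pair? : ∀ a b a′ b′ → Dec ((e : Edge H a b) (e′ : Edge H a′ b′) →
      color (edge⇒~ H e) ≡ color (edge⇒~ H e′) →
      (a ≡ a′ × b ≡ b′) ⊎ (a ≡ b′ × b ≡ a′))
    pair? a b a′ b′ with edge? H a b | edge? H a′ b′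
    ... | no ¬e | _ = yes λ e → contradiction e ¬e
    ... | yes _ | no ¬e′ = yes λ _ e′ → contradiction e′ ¬e′
    ... | yes e | yes e′ = map′
      -- Membership proofs of one edge may differ; independence of the color from the adjacency
      -- proof carries the verdict for `e` and `e′` over to `d` and `d′`.
      (λ f d d′ eq → f (trans (color-irrelevant _ _) (trans eq (color-irrelevant _ _))))
      (λ f → f e e′)
      (color (edge⇒~ H e) Fin.≟ color (edge⇒~ H e′) →-dec
       ((a ≟ⱽ′ a′ ×-dec b ≟ⱽ′ b′) ⊎-dec (a ≟ⱽ′ b′ ×-dec b ≟ⱽ′ a′)))
      where _≟ⱽ′_ = _≟ⱽ_ G

  IsRainbowTreeOn : V → V → V → Subgraph G → Set
  IsRainbowTreeOn x y z H =
    IsTree H × Rainbow c H × Vertex H x × Vertex H y × Vertex H z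

  isRainbowTreeOn? : ∀ x y z H → Dec (IsRainbowTreeOn x y z H)
  isRainbowTreeOn? x y z H = isTree? H ×-dec rainbow? H ×-dec
    vertex? H x ×-dec vertex? H y ×-dec vertex? H z

  isRainbowTreeOn-resp : ∀ {x y z H H′} → H ≐ H′ →
    IsRainbowTreeOn x y z H → IsRainbowTreeOn x y z H′
  isRainbowTreeOn-resp H≐H′ (t , r , x , y , z) =
    isTree-resp H≐H′ t ,
    (λ e e′ eq → r (edge→ (≐-sym H≐H′) e) (edge→ (≐-sym H≐H′) e′)
      (trans (color-irrelevant _ _) (trans eq (color-irrelevant _ _)))) ,
    vertex→ H≐H′ x , vertex→ H≐H′ y , vertex→ H≐H′ z

-- Subgraphs as finite tables

module _ (G : Graph) where
  open Graph G
  private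
    index = Inverse.to V↔Fin
    point = Inverse.from V↔Fin

  -- The characteristic vector of the vertex set, followed by the adjacency matrix.
  Table : Set
  Table = Vec Bool order × Vec (Vec Bool order) order

  search-Table : Searchable Table
  search-Table = search-× (search-Vec search-Bool order)
    (search-Vec (search-Vec search-Bool order) order)

  VertexIn : Table → Pred V 0ℓ
  VertexIn (vs , _) v = T (Vec.lookup vs (index v))

  EdgeIn : Table → Rel V 0ℓ
  EdgeIn (_ , es) u v = T (Vec.lookup (Vec.lookup es (index u)) (index v))

  WellFormed : Table → Set
  WellFormed t = ∀ u v → EdgeIn t u v → EdgeIn t v u × u ~ v × VertexIn t u

  wellFormed? : Decidable WellFormed
  wellFormed? t = for-all? (search-V G) λ u → for-all? (search-V G) λ v →
    T? _ →-dec (T? _ ×-dec u ~? v ×-dec T? _)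

  subgraph : ∀ t → WellFormed t → Subgraph G
  subgraph t wf = record
    { Vertex   = VertexIn t
    ; vertex?  = λ _ → T? _
    ; Edge     = EdgeIn t
    ; edge?    = λ _ _ → T? _
    ; edge-sym = λ e → proj₁ (wf _ _ e)
    ; edge⇒~   = λ e → proj₁ (proj₂ (wf _ _ e))
    ; source∈  = λ e → proj₂ (proj₂ (wf _ _ e))
    }

  module _ (H : Subgraph G) where
    open Subgraph H

    table : Table
    table = Vec.tabulate (λ i → isYes (vertex? (point i))) ,
      Vec.tabulate λ i → Vec.tabulate λ j → isYes (edge? (point i) (point j))

    private
      T-isYes : {A : Set} (a? : Dec A) {b : Bool} → b ≡ isYes a? → A ⇔ T b
      T-isYes a? refl = mk⇔ fromWitness toWitness

      point-index : ∀ v → point (index v) ≡ v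
      point-index = Inverse.strictlyInverseʳ V↔Fin

    vertex-table : ∀ {v} → Vertex v ⇔ VertexIn table v
    vertex-table {v} = T-isYes (vertex? v) (trans
      (lookup∘tabulate _ (index v))
      (cong (isYes ∘ vertex?) (point-index v)))

    edge-table : ∀ {u v} → Edge u v ⇔ EdgeIn table u v
    edge-table {u} {v} = T-isYes (edge? u v) (trans
      (trans (cong (λ r → Vec.lookup r (index v)) (lookup∘tabulate _ (index u)))
             (lookup∘tabulate _ (index v)))
      (cong₂ (λ u v → isYes (edge? u v)) (point-index u) (point-index v)))

    table-wellFormed : WellFormed table
    table-wellFormed u v e =
      Equivalence.to edge-table (edge-sym e′) , edge⇒~ e′ ,
      Equivalence.to vertex-table (source∈ e′)
      where e′ = Equivalence.from edge-table e

    ≐-table : H ≐ subgraph table table-wellFormed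
    ≐-table = record { vertex⇔ = vertex-table ; edge⇔ = edge-table }

module _ {G : Graph} {k : ℕ} (c : EdgeColoring G k) where
  open Graph G

  -- Every subgraph agrees with its own table, and rainbow trees are preserved by `≐`, so a search
  -- through the well-formed tables is exhaustive.
  rainbowTreeOn? : ∀ x y z → Dec (Σ[ H ∈ Subgraph G ] IsRainbowTreeOn c x y z H)
  rainbowTreeOn? x y z = map′
    (λ { (t , wf , r) → subgraph G t wf , r })
    (λ { (H , r) → table G H , table-wellFormed G H ,
                   isRainbowTreeOn-resp c (≐-table G H) r })
    (search-Table G tableOn?)
    where
    TableOn : Pred (Table G) 0ℓ
    TableOn t = Σ[ wf ∈ WellFormed G t ] IsRainbowTreeOn c x y z (subgraph G t wf)

    tableOn? : Decidable TableOn
    tableOn? t with wellFormed? G t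
    ... | no ¬wf = no (¬wf ∘ proj₁)
    ... | yes wf = map′ {B = TableOn t} (wf ,_)
      (λ { (wf′ , r) → isRainbowTreeOn-resp c (same wf′) r })
      (isRainbowTreeOn? c x y z (subgraph G t wf))
      where
      same : ∀ wf′ → subgraph G t wf′ ≐ subgraph G t wf
      same wf′ = record { vertex⇔ = ⇔-id _ ; edge⇔ = ⇔-id _ }

  isRainbow₃? : Dec (IsRainbow₃ c)
  isRainbow₃? =
    for-all? (search-V G) λ x → for-all? (search-V G) λ y → for-all? (search-V G) λ z →
      x ≢? y →-dec x ≢? z →-dec y ≢? z →-dec rainbowTreeOn? x y z
    where
    _≢?_ : ∀ x y → Dec (x ≢ y)
    x ≢? y = ¬? (_≟ⱽ_ G x y)

-- Colorings of complete bipartite graphs as matrices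

module _ {s t k : ℕ} where

  matrixColor : (Fin s → Fin t → Fin k) →
    ∀ {u v : Fin s ⊎ Fin t} → BipartiteAdj u v → Fin k
  matrixColor m (left-right {i} {j}) = m i j
  matrixColor m (right-left {i} {j}) = m i j

  matrixColoring : (Fin s → Fin t → Fin k) → EdgeColoring (K s t) k
  matrixColoring m = record
    { color     = matrixColor m
    ; color-sym = λ { left-right right-left → refl ; right-left left-right → refl }
    }

  color-matrix : (c : EdgeColoring (K s t) k) → let open EdgeColoring c in
    ∀ {m} → (∀ i j → m i j ≡ color (left-right {i = i} {j})) →
    ∀ {u v} (p : BipartiteAdj u v) → matrixColor m p ≡ color p
  color-matrix c eq left-right = eq _ _
  color-matrix c eq right-left = trans (eq _ _) (EdgeColoring.color-sym c _ _)

isRainbow₃-resp : {G : Graph} {k : ℕ} (c d : EdgeColoring G k) →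
  (let open Graph G; open EdgeColoring) →
  (∀ {u v} (p : u ~ v) → color d p ≡ color c p) → IsRainbow₃ c → IsRainbow₃ d
isRainbow₃-resp c d d≡c rainbow₃ x y z x≢y x≢z y≢z with rainbow₃ x y z x≢y x≢z y≢z
... | T , tree , rainbow , on = T , tree ,
  (λ e e′ eq → rainbow e e′ (trans (sym (d≡c _)) (trans eq (d≡c _)))) , on

tableColoring : ∀ {s t k} → Vec (Vec (Fin k) t) s → EdgeColoring (K s t) k
tableColoring m = matrixColoring λ i j → Vec.lookup (Vec.lookup m i) j

colorTable : ∀ {s t k} → EdgeColoring (K s t) k → Vec (Vec (Fin k) t) s
colorTable c = Vec.tabulate λ i → Vec.tabulate λ j →
  EdgeColoring.color c (left-right {i = i} {j})

isRainbow₃-colorTable : ∀ {s t k} (c : EdgeColoring (K s t) k) →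
  IsRainbow₃ c → IsRainbow₃ (tableColoring (colorTable c))
isRainbow₃-colorTable c = isRainbow₃-resp c (tableColoring (colorTable c))
  (color-matrix c λ i j → trans
    (cong (λ row → Vec.lookup row j) (lookup∘tabulate _ i))
    (lookup∘tabulate _ j))

colorable? : ∀ s t → Decidable (Rainbow₃Colorable (K s t))
colorable? s t k = map′ to from
  (search-Vec (search-Vec Fin.any? t) s {P = RainbowTable} λ m →
    isRainbow₃? (tableColoring m))
  where
  RainbowTable : Pred (Vec (Vec (Fin k) t) s) _
  RainbowTable m = IsRainbow₃ (tableColoring m)

  to : ∃ RainbowTable → Rainbow₃Colorable (K s t) k
  to (m , r) = tableColoring m , r

  from : Rainbow₃Colorable (K s t) k → ∃ RainbowTable
  from (c , r) = colorTable c , isRainbow₃-colorTable c r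

rx₃-exists : ∀ s t k → Rainbow₃Colorable (K s t) k → ∃[ r ] (IsRx₃ (K s t) r × r ≤ k)
rx₃-exists s t k c =
  let r , colorable , minimal , r≤k = least (colorable? s t) k c
  in r , record { colorable = colorable ; minimal = minimal } , r≤k

-- Growing rainbow trees

module _ {A : Set} where

  head∈ : ∀ xs {a : A} → head xs ≡ just a → a ∈ xs
  head∈ (_ ∷ _) refl = here refl

  last∈ : ∀ xs {z : A} → last xs ≡ just z → z ∈ xs
  last∈ (_ ∷ [])     refl = here refl
  last∈ (_ ∷ y ∷ xs) eq   = there (last∈ (y ∷ xs) eq)

  module _ {E : Rel A 0ℓ} (E-sym : Symmetric E) where

    TwoNeighbours : A → Set
    TwoNeighbours v = ∃₂ λ p q → p ≢ q × E v p × E v q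

    private
      -- Here `a` is the first vertex of the cycle and `p` the one just before `ys`. An inner vertex
      -- has its predecessor and successor as neighbours; the last one has its predecessor and `a`.
      neighbours-after : ∀ {a p v z} ys → Linked E (p ∷ ys) → Unique (p ∷ ys) →
        last (p ∷ ys) ≡ just z → E z a → All (a ≢_) (p ∷ ys) → v ∈ ys → TwoNeighbours v
      neighbours-after (v ∷ []) (pv ∷ _) _ refl va (a≢p ∷ _) (here refl) =
        _ , _ , a≢p , va , E-sym pv
      neighbours-after (v ∷ s ∷ _) (pv ∷ vs ∷ _) ((_ ∷ p≢s ∷ _) ∷ _) _ _ _ (here refl) =
        _ , _ , p≢s , E-sym pv , vs
      neighbours-after (y ∷ s ∷ ys) (_ ∷ l) (_ ∷ u) z za (_ ∷ a∉) (there v∈) =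
        neighbours-after (s ∷ ys) l u z za a∉ v∈

    cycle-neighbours : ∀ {a z v} xs → head xs ≡ just a → last xs ≡ just z →
      Linked E xs → Unique xs → 3 ≤ length xs → E z a → v ∈ xs → TwoNeighbours v
    cycle-neighbours (a ∷ []) _ _ _ _ (s≤s ()) _ _
    cycle-neighbours (a ∷ b ∷ []) _ _ _ _ (s≤s (s≤s ())) _ _
    -- The neighbours of the first vertex are the second and the last one, which differ because the
    -- cycle has length at least three.
    cycle-neighbours (a ∷ b ∷ c ∷ xs) refl z (ab ∷ _) (_ ∷ b∉ ∷ _) _ za (here refl) =
      _ , _ , All.lookup b∉ (last∈ (c ∷ xs) z) , ab , E-sym za
    cycle-neighbours (a ∷ b ∷ c ∷ xs) refl z (ab ∷ bc ∷ _) ((_ ∷ a≢c ∷ _) ∷ _) _ za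
      (there (here refl)) = _ , _ , a≢c , E-sym ab , bc
    cycle-neighbours (a ∷ b ∷ c ∷ xs) refl z (_ ∷ l) (a∉ ∷ u) _ za
      (there (there v∈)) = neighbours-after (c ∷ xs) l u z za a∉ v∈

module _ {A : Set} where

  -- An inductive counterpart of `IsPath`, convenient for attaching a new leaf at the front by
  -- `step` or at the back by `snoc`.
  data Path (E : Rel A 0ℓ) : A → A → List A → Set where
    stop : ∀ {u} → Path E u u [ u ]
    step : ∀ {u v w xs} → E u v → All (u ≢_) xs → Path E v w xs → Path E u w (u ∷ xs)

  map-Path : ∀ {E F : Rel A 0ℓ} → (∀ {u v} → E u v → F u v) →
    ∀ {u v xs} → Path E u v xs → Path F u v xs
  map-Path f stop          = stop
  map-Path f (step e u∉ p) = step (f e) u∉ (map-Path f p)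

  module _ {E : Rel A 0ℓ} where

    snoc : ∀ {u v w xs} → Path E u v xs → E v w → All (_≢ w) xs → Path E u w (xs ∷ʳ w)
    snoc stop          vw (v≢w ∷ []) = step vw (v≢w ∷ []) stop
    snoc (step e u∉ p) vw (u≢w ∷ w∉) = step e (All.∷ʳ⁺ u∉ u≢w) (snoc p vw w∉)

    path-head : ∀ {u v xs} → Path E u v xs → head xs ≡ just u
    path-head stop         = refl
    path-head (step _ _ _) = refl

    path-last : ∀ {u v xs} → Path E u v xs → last xs ≡ just v
    path-last stop                       = refl
    path-last (step _ _ stop)            = refl
    path-last (step _ _ p@(step _ _ _))  = path-last p

    path-linked : ∀ {u v xs} → Path E u v xs → Linked E xs
    path-linked stop                        = [-]
    path-linked (step e _ stop)             = e ∷ [-]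
    path-linked (step e _ p@(step _ _ _))   = e ∷ path-linked p

    path-unique : ∀ {u v xs} → Path E u v xs → Unique xs
    path-unique stop          = [] ∷ []
    path-unique (step _ u∉ p) = u∉ ∷ path-unique p

module _ {G : Graph} {k : ℕ} (c : EdgeColoring G k) where
  open Graph G
  open EdgeColoring c

  open Membership (_≟ⱽ_ G) using (_∈?_)

  -- A rainbow tree built by adding leaves, with its vertices and the colors used so far. Freshness
  -- of `v` rules out cycles; freshness of the color keeps the tree rainbow.
  data Growth : List V → List (Fin k) → Set where
    root : ∀ v → Growth [ v ] []
    grow : ∀ {u v vs cs} → Growth vs cs → u ∈ vs → v ∉ vs →
      (uv : u ~ v) → color uv ∉ cs → Growth (v ∷ vs) (color uv ∷ cs)

  TreeEdge : ∀ {vs cs} → Growth vs cs → Rel V 0ℓ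
  TreeEdge (root _) a b = ⊥
  TreeEdge (grow {u} {v} g _ _ _ _) a b =
    TreeEdge g a b ⊎ ((a ≡ u × b ≡ v) ⊎ (a ≡ v × b ≡ u))

  treeEdge? : ∀ {vs cs} (g : Growth vs cs) a b → Dec (TreeEdge g a b)
  treeEdge? (root _) a b = no λ ()
  treeEdge? (grow {u} {v} g _ _ _ _) a b = treeEdge? g a b ⊎-dec
    ((a ≟ u ×-dec b ≟ v) ⊎-dec (a ≟ v ×-dec b ≟ u))
    where _≟_ = _≟ⱽ_ G

  treeEdge-sym : ∀ {vs cs} (g : Growth vs cs) → Symmetric (TreeEdge g)
  treeEdge-sym (grow g _ _ _ _) (inj₁ e) = inj₁ (treeEdge-sym g e)
  treeEdge-sym (grow g _ _ _ _) (inj₂ (inj₁ (a , b))) = inj₂ (inj₂ (b , a))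
  treeEdge-sym (grow g _ _ _ _) (inj₂ (inj₂ (a , b))) = inj₂ (inj₁ (b , a))

  treeEdge⇒~ : ∀ {vs cs} (g : Growth vs cs) {a b} → TreeEdge g a b → a ~ b
  treeEdge⇒~ (grow g _ _ _ _) (inj₁ e) = treeEdge⇒~ g e
  treeEdge⇒~ (grow _ _ _ uv _) (inj₂ (inj₁ (refl , refl))) = uv
  treeEdge⇒~ (grow _ _ _ uv _) (inj₂ (inj₂ (refl , refl))) = ~-sym uv

  treeEdge-source : ∀ {vs cs} (g : Growth vs cs) {a b} → TreeEdge g a b → a ∈ vs
  treeEdge-source (grow g _ _ _ _) (inj₁ e) = there (treeEdge-source g e)
  treeEdge-source (grow _ u∈ _ _ _) (inj₂ (inj₁ (refl , _))) = there u∈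
  treeEdge-source (grow _ _ _ _ _) (inj₂ (inj₂ (refl , _))) = here refl

  treeEdge-color : ∀ {vs cs} (g : Growth vs cs) {a b} (e : TreeEdge g a b) →
    color (treeEdge⇒~ g e) ∈ cs
  treeEdge-color (grow g _ _ _ _) (inj₁ e) = there (treeEdge-color g e)
  treeEdge-color (grow _ _ _ _ _) (inj₂ (inj₁ (refl , refl))) = here refl
  treeEdge-color (grow _ _ _ _ _) (inj₂ (inj₂ (refl , refl))) = here (color-sym _ _)

  tree : ∀ {vs cs} → Growth vs cs → Subgraph G
  tree {vs} g = record
    { Vertex   = _∈ vs
    ; vertex?  = _∈? vs
    ; Edge     = TreeEdge g
    ; edge?    = treeEdge? g
    ; edge-sym = treeEdge-sym g
    ; edge⇒~   = treeEdge⇒~ g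
    ; source∈  = treeEdge-source g
    }

  -- A path to or from the new leaf passes through its parent `u`. That older paths stay inside `vs`
  -- is recorded because it shows that they avoid the leaf.
  tree-path : ∀ {vs cs} (g : Growth vs cs) {a b} → a ∈ vs → b ∈ vs →
    ∃[ xs ] (Path (TreeEdge g) a b xs × All (_∈ vs) xs)
  tree-path (root _) (here refl) (here refl) = _ , stop , here refl ∷ []
  tree-path (grow g u∈ v∉ _ _) (here refl) (here refl) = _ , stop , here refl ∷ []
  tree-path (grow g u∈ v∉ _ _) (here refl) (there b∈) =
    let xs , p , xs⊆ = tree-path g u∈ b∈ in
    _ , step (inj₂ (inj₂ (refl , refl)))
             (All.map (λ x∈ v≡x → v∉ (subst (_∈ _) (sym v≡x) x∈)) xs⊆) (map-Path inj₁ p) ,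
    here refl ∷ All.map there xs⊆
  tree-path (grow g u∈ v∉ _ _) (there a∈) (here refl) =
    let xs , p , xs⊆ = tree-path g a∈ u∈ in
    _ , snoc (map-Path inj₁ p) (inj₂ (inj₁ (refl , refl)))
             (All.map (λ x∈ x≡v → v∉ (subst (_∈ _) x≡v x∈)) xs⊆) ,
    All.∷ʳ⁺ (All.map there xs⊆) (here refl)
  tree-path (grow g u∈ v∉ _ _) (there a∈) (there b∈) =
    let xs , p , xs⊆ = tree-path g a∈ b∈ in _ , map-Path inj₁ p , All.map there xs⊆

  tree-connected : ∀ {vs cs} (g : Growth vs cs) → Connected (tree g)
  tree-connected g a∈ b∈ = let xs , p , _ = tree-path g a∈ b∈ in xs , record
    { starts = path-head p ; ends = path-last p
    ; linked = path-linked p ; unique = path-unique p }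

  -- Each vertex of a cycle has two distinct neighbours, whereas the newest leaf has only its
  -- parent. Hence a cycle avoids that leaf and already lies in the smaller tree.
  tree-acyclic : ∀ {vs cs} (g : Growth vs cs) → Acyclic (tree g)
  tree-acyclic (root _) c = IsCycle.closes c
  tree-acyclic g′@(grow {u} {v} g u∈ v∉ _ _) {a} {z} {xs} c with v ∈? xs
  ... | yes v∈ = let p , q , p≢q , vp , vq = neighbours in
    p≢q (trans (leaf vp) (sym (leaf vq)))
    where
    open IsCycle c
    open IsPath path
    neighbours = cycle-neighbours (treeEdge-sym g′) xs starts ends linked unique long closes v∈

    leaf : ∀ {p} → TreeEdge g′ v p → p ≡ u
    leaf (inj₁ e) = contradiction (treeEdge-source g e) v∉
    leaf (inj₂ (inj₁ (refl , _))) = contradiction u∈ v∉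
    leaf (inj₂ (inj₂ (_ , p≡u))) = p≡u
  ... | no v∉xs = tree-acyclic g record
    { path = record { starts = starts ; ends = ends
                    ; linked = old-linked linked (λ x∈ → x∈) ; unique = unique }
    ; long = long
    ; closes = old closes (last∈ xs ends) (head∈ xs starts)
    }
    where
    open IsCycle c
    open IsPath path

    old : ∀ {x y} → TreeEdge g′ x y → x ∈ xs → y ∈ xs → TreeEdge g x y
    old (inj₁ e) _ _ = e
    old (inj₂ (inj₁ (_ , refl))) _ y∈ = contradiction y∈ v∉xs
    old (inj₂ (inj₂ (refl , _))) x∈ _ = contradiction x∈ v∉xs

    old-linked : ∀ {ys} → Linked (TreeEdge g′) ys → (∀ {y} → y ∈ ys → y ∈ xs) →
      Linked (TreeEdge g) ys
    old-linked []      _  = []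
    old-linked [-]     _  = [-]
    old-linked (e ∷ l) ⊆ = old e (⊆ (here refl)) (⊆ (there (here refl))) ∷
      old-linked l (⊆ ∘ there)

  tree-isTree : ∀ {vs cs} (g : Growth vs cs) → IsTree (tree g)
  tree-isTree g = record
    { nonempty  = nonempty g
    ; connected = tree-connected g
    ; acyclic   = tree-acyclic g
    }
    where
    nonempty : ∀ {vs cs} → Growth vs cs → ∃ (_∈ vs)
    nonempty (root v)           = v , here refl
    nonempty (grow _ _ _ _ _)   = _ , here refl

  -- All older edges have colors in `cs`, and the newest edge has not.
  tree-rainbow : ∀ {vs cs} (g : Growth vs cs) → Rainbow c (tree g)
  tree-rainbow (grow g _ _ _ _) (inj₁ e) (inj₁ e′) eq = tree-rainbow g e e′ eq
  tree-rainbow (grow g _ _ _ c∉) (inj₁ e) (inj₂ (inj₁ (refl , refl))) eq =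
    contradiction (subst (_∈ _) eq (treeEdge-color g e)) c∉
  tree-rainbow (grow g _ _ _ c∉) (inj₁ e) (inj₂ (inj₂ (refl , refl))) eq =
    contradiction (subst (_∈ _) (trans eq (color-sym _ _)) (treeEdge-color g e)) c∉
  tree-rainbow (grow g _ _ _ c∉) (inj₂ (inj₁ (refl , refl))) (inj₁ e) eq =
    contradiction (subst (_∈ _) (sym eq) (treeEdge-color g e)) c∉
  tree-rainbow (grow g _ _ _ c∉) (inj₂ (inj₂ (refl , refl))) (inj₁ e) eq =
    contradiction (subst (_∈ _) (trans (sym eq) (color-sym _ _)) (treeEdge-color g e)) c∉
  tree-rainbow (grow _ _ _ _ _) (inj₂ (inj₁ (refl , refl))) (inj₂ (inj₁ (refl , refl))) _ =
    inj₁ (refl , refl)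
  tree-rainbow (grow _ _ _ _ _) (inj₂ (inj₁ (refl , refl))) (inj₂ (inj₂ (refl , refl))) _ =
    inj₂ (refl , refl)
  tree-rainbow (grow _ _ _ _ _) (inj₂ (inj₂ (refl , refl))) (inj₂ (inj₁ (refl , refl))) _ =
    inj₂ (refl , refl)
  tree-rainbow (grow _ _ _ _ _) (inj₂ (inj₂ (refl , refl))) (inj₂ (inj₂ (refl , refl))) _ =
    inj₁ (refl , refl)

-- Depends on labels only, so that colors of planned edges evaluate even when `s` and `t` are
-- variables. The value `nothing` marks two labels on the same side.
edgeColor : ∀ k .{{_ : NonZero k}} → ℕ ⊎ ℕ → ℕ ⊎ ℕ → Maybe (Fin k)
edgeColor k (inj₁ i) (inj₂ j) = just ((i + j) mod k)
edgeColor k (inj₂ j) (inj₁ i) = just ((i + j) mod k)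
edgeColor k _        _        = nothing

module _ {s t : ℕ} (k : ℕ) .{{_ : NonZero k}} (a : Fin s → ℕ) (b : Fin t → ℕ) where

  sumColoring : EdgeColoring (K s t) k
  sumColoring = matrixColoring λ i j → (a i + b j) mod k

  edgeColor-sound : ∀ u v {γ} →
    edgeColor k (Sum.map a b u) (Sum.map a b v) ≡ just γ →
    Σ[ p ∈ BipartiteAdj u v ] EdgeColoring.color sumColoring p ≡ γ
  edgeColor-sound (inj₁ i) (inj₂ j) refl = left-right , refl
  edgeColor-sound (inj₂ j) (inj₁ i) refl = right-left , refl

-- Plans of trees, to be checked by evaluation

-- Each entry attaches the vertices of the list to the vertex before it.
TreePlan : Set → Set
TreePlan A = List (A × List A)

-- Several symbols may denote the same vertex; those that do have equal codes.
module Plans (k : ℕ) .{{_ : NonZero k}} {A : Set} (_≟_ : DecidableEquality A)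
  (code : A → A) (label : A → ℕ ⊎ ℕ) where

  _Contains_ : List A → A → Set
  vs Contains v = Any (λ w → code v ≡ code w) vs

  contains? : ∀ vs v → Dec (vs Contains v)
  contains? vs v = any? (λ w → code v ≟ code w) vs

  Grows : List A → List (Fin k) → List (A × A) → Set
  Grows vs cs []             = ⊤
  Grows vs cs ((u , v) ∷ es) = vs Contains u × ¬ (vs Contains v) ×
    Maybe.Any (λ γ → γ ∉ cs × Grows (v ∷ vs) (γ ∷ cs) es) (edgeColor k (label u) (label v))

  grows? : ∀ vs cs es → Dec (Grows vs cs es)
  grows? vs cs []             = yes tt
  grows? vs cs ((u , v) ∷ es) = contains? vs u ×-dec ¬? (contains? vs v) ×-dec
    Maybe.dec (λ γ → ¬? (γ ∈? cs) ×-dec grows? (v ∷ vs) (γ ∷ cs) es) _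
    where open Membership (Fin._≟_ {k}) using (_∈?_)

  edges : TreePlan A → List (A × A)
  edges = concatMap λ { (u , vs) → map (u ,_) vs }

  grown : List A → List (A × A) → List A
  grown vs []             = vs
  grown vs ((_ , v) ∷ es) = grown (v ∷ vs) es

  Covers : A → A → A → TreePlan A → Set
  Covers x y z []               = ⊥
  Covers x y z plan@((u , _) ∷ _) =
    ws Contains x × ws Contains y × ws Contains z × Grows [ u ] [] (edges plan)
    where ws = grown [ u ] (edges plan)

  covers? : ∀ x y z plan → Dec (Covers x y z plan)
  covers? x y z []      = no λ ()
  covers? x y z (_ ∷ _) =
    contains? _ x ×-dec contains? _ y ×-dec contains? _ z ×-dec grows? _ _ _

  module _ {s t : ℕ} {a : Fin s → ℕ} {b : Fin t → ℕ} (φ : A → Fin s ⊎ Fin t)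
    (code-faithful : ∀ {u v} → code u ≡ code v → φ u ≡ φ v)
    (code-complete : ∀ {u v} → φ u ≡ φ v → code u ≡ code v)
    (label-φ : ∀ u → label u ≡ Sum.map a b (φ u)) where

    private
      c = sumColoring k a b

      contains⇒∈ : ∀ {v} vs → vs Contains v → φ v ∈ map φ vs
      contains⇒∈ _ = Any.map⁺ ∘ Any.map code-faithful

      ∈⇒contains : ∀ {v} vs → φ v ∈ map φ vs → vs Contains v
      ∈⇒contains _ = Any.map code-complete ∘ Any.map⁻

    -- Faithfulness of the codes turns membership of `u` among the symbols into membership among the
    -- vertices; completeness does the same for the freshness of `v`, a negated membership.
    grows-sound : ∀ {vs cs} es → Grows vs cs es → Growth c (map φ vs) cs →
      ∃[ cs′ ] Growth c (map φ (grown vs es)) cs′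
    grows-sound []             _ g = _ , g
    grows-sound {vs} {cs} ((u , v) ∷ es) (u∈ , v∉ , colored) g =
      -- The planned color is generalized to `m` together with its equation, so that matching on it
      -- does not lose the link to the edge of the graph.
      next (edgeColor k (label u) (label v)) refl colored
      where
      next : ∀ m → edgeColor k (label u) (label v) ≡ m →
        Maybe.Any (λ γ → γ ∉ cs × Grows (v ∷ vs) (γ ∷ cs) es) m →
        ∃[ cs′ ] Growth c (map φ (grown (v ∷ vs) es)) cs′
      next (just γ) eq (just (γ∉ , gs))
        rewrite label-φ u | label-φ v with edgeColor-sound k a b (φ u) (φ v) eq
      ... | uv , refl = grows-sound es gs (grow g (contains⇒∈ vs u∈) (v∉ ∘ ∈⇒contains vs) uv γ∉)

    covers-sound : ∀ {x y z plan} → Covers x y z plan →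
      Σ[ T ∈ Subgraph (K s t) ] IsRainbowTreeOn c (φ x) (φ y) (φ z) T
    covers-sound {plan = plan@((u , _) ∷ _)} (x∈ , y∈ , z∈ , gs) =
      let _ , g = grows-sound (edges plan) gs (root (φ u)) in
      tree c g , tree-isTree c g , tree-rainbow c g ,
      contains⇒∈ _ x∈ , contains⇒∈ _ y∈ , contains⇒∈ _ z∈

infix 4 _⟶_
pattern _⟶_ u vs = u , vs

pattern l i = inj₁ i
pattern r j = inj₂ j

-- The four cases with fewer than six colors

module Small (s t k : ℕ) .{{_ : NonZero k}} where

  open Plans k (Sum.≡-dec (Fin._≟_ {s}) (Fin._≟_ {t})) id (Sum.map toℕ toℕ)

  covering? : (plans : List (TreePlan (Fin s ⊎ Fin t))) →
    Dec (∀ x y z → Any (Covers x y z) plans)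
  covering? plans = for-all? search λ x → for-all? search λ y → for-all? search λ z →
    any? (covers? x y z) plans
    where
    search : Searchable (Fin s ⊎ Fin t)
    search = search-⊎ Fin.any? Fin.any?

  colorable : ∀ plans → True (covering? plans) → Rainbow₃Colorable (K s t) k
  colorable plans covering = sumColoring k toℕ toℕ , λ x y z _ _ _ →
    covers-sound id id id (λ _ → refl) (proj₂ (Any.satisfied (toWitness covering x y z)))

-- In each of the four small cases every listed tree uses all s + t - 3 colors and so misses exactly
-- two vertices; a triple is covered once it avoids some missed pair. Here these pairs form two
-- disjoint triangles, `l 0F`, `r 0F`, `r 2F` and `l 1F`, `l 2F`, `r 1F`, and meeting all of them
-- takes four vertices.
colorable-3-3 : Rainbow₃Colorable (K 3 3) 3
colorable-3-3 = Small.colorable 3 3 3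
  ( ((l 0F ⟶ r 0F ∷ r 2F ∷ []) ∷ (r 2F ⟶ l 2F ∷ []) ∷ [])
  ∷ ((l 0F ⟶ r 0F ∷ r 1F ∷ r 2F ∷ []) ∷ [])
  ∷ ((l 1F ⟶ r 1F ∷ r 2F ∷ []) ∷ (r 2F ⟶ l 2F ∷ []) ∷ [])
  ∷ ((l 1F ⟶ r 0F ∷ r 1F ∷ []) ∷ (r 1F ⟶ l 2F ∷ []) ∷ [])
  ∷ ((l 0F ⟶ r 0F ∷ r 2F ∷ []) ∷ (r 0F ⟶ l 1F ∷ []) ∷ [])
  ∷ ((l 0F ⟶ r 1F ∷ []) ∷ (r 1F ⟶ l 1F ∷ l 2F ∷ []) ∷ [])
  ∷ []
  ) tt

-- The missed pairs form the triangle `l 1F`, `l 2F`, `r 3F` and two further disjoint pairs; again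
-- no three vertices meet all of them.
colorable-3-4 : Rainbow₃Colorable (K 3 4) 4
colorable-3-4 = Small.colorable 3 4 4
  ( ((l 0F ⟶ r 0F ∷ r 1F ∷ r 2F ∷ r 3F ∷ []) ∷ [])
  ∷ ((l 0F ⟶ r 0F ∷ r 1F ∷ r 2F ∷ []) ∷ (r 1F ⟶ l 2F ∷ []) ∷ [])
  ∷ ((l 0F ⟶ r 0F ∷ r 3F ∷ []) ∷ (r 0F ⟶ l 1F ∷ l 2F ∷ []) ∷ [])
  ∷ ((l 0F ⟶ r 0F ∷ r 1F ∷ r 2F ∷ []) ∷ (r 2F ⟶ l 1F ∷ []) ∷ [])
  ∷ ((l 1F ⟶ r 1F ∷ r 2F ∷ r 3F ∷ []) ∷ (r 3F ⟶ l 2F ∷ []) ∷ [])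
  ∷ []
  ) tt

-- The four missed pairs partition the eight vertices, so any triple avoids one of them.
colorable-3-5 : Rainbow₃Colorable (K 3 5) 5
colorable-3-5 = Small.colorable 3 5 5
  ( ((l 0F ⟶ r 0F ∷ r 1F ∷ r 2F ∷ r 3F ∷ r 4F ∷ []) ∷ [])
  ∷ ((l 0F ⟶ r 0F ∷ r 1F ∷ r 2F ∷ []) ∷ (r 2F ⟶ l 1F ∷ l 2F ∷ []) ∷ [])
  ∷ ((l 0F ⟶ r 0F ∷ r 3F ∷ r 4F ∷ []) ∷ (r 0F ⟶ l 1F ∷ l 2F ∷ []) ∷ [])
  ∷ ((l 1F ⟶ r 1F ∷ r 2F ∷ r 3F ∷ r 4F ∷ []) ∷ (r 4F ⟶ l 2F ∷ []) ∷ [])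
  ∷ []
  ) tt

-- Again the four missed pairs partition the eight vertices.
colorable-4-4 : Rainbow₃Colorable (K 4 4) 5
colorable-4-4 = Small.colorable 4 4 5
  ( ((l 0F ⟶ r 0F ∷ r 1F ∷ r 2F ∷ r 3F ∷ []) ∷ (r 1F ⟶ l 3F ∷ []) ∷ [])
  ∷ ((l 0F ⟶ r 0F ∷ r 1F ∷ r 2F ∷ []) ∷ (r 2F ⟶ l 1F ∷ l 2F ∷ []) ∷ [])
  ∷ ((l 0F ⟶ r 0F ∷ r 3F ∷ []) ∷ (r 0F ⟶ l 2F ∷ []) ∷ (r 3F ⟶ l 1F ∷ l 3F ∷ []) ∷ [])
  ∷ ((l 1F ⟶ r 1F ∷ r 2F ∷ r 3F ∷ []) ∷ (r 3F ⟶ l 2F ∷ l 3F ∷ []) ∷ [])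
  ∷ []
  ) tt

-- Six colors

-- The first three vertices of each side.
Core : Set
Core = Fin 3 ⊎ Fin 3

-- The two last summands stand for the clones on the left and on the right.
Kind : Set
Kind = Core ⊎ (Fin 1 ⊎ Fin 1)

-- A core vertex, or one of the three vertices to be connected; the latter may
-- itself lie in the core, and is then encoded as a core vertex.
Symbol : Set
Symbol = Core ⊎ Fin 3

pattern L i = inj₁ (inj₁ i)
pattern R j = inj₁ (inj₂ j)
pattern X i = inj₂ i

-- This is min {i, 3}, written with the case split that `kind` uses as well.
clip : ∀ {n} → Fin (3 + n) → ℕ
clip i = [ toℕ , const 3 ]′ (splitAt 3 i)

kindLabel : Kind → ℕ ⊎ ℕ
kindLabel = [ Sum.map toℕ toℕ , Sum.map (const 3) (const 3) ]′

module _ (kinds : Vec Kind 3) where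

  symbolCode : Symbol → Symbol
  symbolCode (inj₁ v) = inj₁ v
  symbolCode (inj₂ i) = [ inj₁ , const (inj₂ i) ]′ (Vec.lookup kinds i)

  symbolLabel : Symbol → ℕ ⊎ ℕ
  symbolLabel (inj₁ v) = Sum.map toℕ toℕ v
  symbolLabel (inj₂ i) = kindLabel (Vec.lookup kinds i)

  open Plans 6 (Sum.≡-dec (Sum.≡-dec Fin._≟_ Fin._≟_) Fin._≟_) symbolCode symbolLabel public
    using (covers?; covers-sound) renaming (Covers to SymbolCovers)

-- Lets one plan serve every order in which the terminals may be given.
relabel : Vec (Fin 3) 3 → TreePlan Symbol → TreePlan Symbol
relabel π = map (Product.map (Sum.map₂ (Vec.lookup π)) (map (Sum.map₂ (Vec.lookup π))))

permutations : List (Vec (Fin 3) 3)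
permutations =
    (0F ∷ 1F ∷ 2F ∷ []) ∷ (0F ∷ 2F ∷ 1F ∷ []) ∷ (1F ∷ 0F ∷ 2F ∷ [])
  ∷ (1F ∷ 2F ∷ 0F ∷ []) ∷ (2F ∷ 0F ∷ 1F ∷ []) ∷ (2F ∷ 1F ∷ 0F ∷ []) ∷ []

-- Sorted by the clones among the terminals: none; one right; one left; two right; one left and one
-- right; two left; three right; one left and two right; two left and one right; three left. Each
-- case of two clones has two plans, which miss different single core vertices and so together reach
-- any third terminal in the core.
clonePlans : List (TreePlan Symbol)
clonePlans =
  ((L 0F ⟶ R 0F ∷ R 1F ∷ R 2F ∷ []) ∷ (R 2F ⟶ L 1F ∷ L 2F ∷ []) ∷ []) ∷
  concatMap (λ plan → map (λ π → relabel π plan) permutations)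
    ( ((L 0F ⟶ R 0F ∷ R 1F ∷ R 2F ∷ X 0F ∷ []) ∷ (X 0F ⟶ L 1F ∷ L 2F ∷ []) ∷ [])
    ∷ ((L 0F ⟶ R 0F ∷ R 1F ∷ R 2F ∷ []) ∷ (R 2F ⟶ L 1F ∷ L 2F ∷ X 0F ∷ []) ∷ [])
    ∷ ((L 0F ⟶ R 0F ∷ R 1F ∷ X 0F ∷ []) ∷ (R 0F ⟶ L 2F ∷ []) ∷ (X 0F ⟶ L 1F ∷ [])
       ∷ (L 2F ⟶ X 1F ∷ []) ∷ [])
    ∷ ((L 0F ⟶ R 0F ∷ R 1F ∷ R 2F ∷ X 0F ∷ []) ∷ (R 2F ⟶ L 2F ∷ [])
       ∷ (L 2F ⟶ X 1F ∷ []) ∷ [])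
    ∷ ((L 0F ⟶ R 0F ∷ R 1F ∷ R 2F ∷ X 1F ∷ []) ∷ (R 1F ⟶ X 0F ∷ [])
       ∷ (X 1F ⟶ L 2F ∷ []) ∷ [])
    ∷ ((L 0F ⟶ R 0F ∷ R 1F ∷ R 2F ∷ X 1F ∷ []) ∷ (R 2F ⟶ X 0F ∷ [])
       ∷ (X 1F ⟶ L 1F ∷ []) ∷ [])
    ∷ ((L 0F ⟶ R 0F ∷ R 1F ∷ R 2F ∷ []) ∷ (R 1F ⟶ X 0F ∷ [])
       ∷ (R 2F ⟶ L 1F ∷ X 1F ∷ []) ∷ [])
    ∷ ((L 0F ⟶ R 0F ∷ R 1F ∷ R 2F ∷ []) ∷ (R 0F ⟶ X 0F ∷ [])
       ∷ (R 2F ⟶ L 2F ∷ X 1F ∷ []) ∷ [])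
    ∷ ((L 0F ⟶ R 0F ∷ X 0F ∷ []) ∷ (R 0F ⟶ L 1F ∷ L 2F ∷ []) ∷ (L 1F ⟶ X 1F ∷ [])
       ∷ (L 2F ⟶ X 2F ∷ []) ∷ [])
    ∷ ((L 0F ⟶ R 0F ∷ R 1F ∷ X 1F ∷ []) ∷ (R 0F ⟶ L 2F ∷ []) ∷ (R 1F ⟶ X 0F ∷ [])
       ∷ (L 2F ⟶ X 2F ∷ []) ∷ [])
    ∷ ((L 0F ⟶ R 0F ∷ R 1F ∷ R 2F ∷ X 2F ∷ []) ∷ (R 1F ⟶ X 0F ∷ [])
       ∷ (R 2F ⟶ X 1F ∷ []) ∷ [])
    ∷ ((L 0F ⟶ R 0F ∷ R 1F ∷ R 2F ∷ []) ∷ (R 0F ⟶ X 0F ∷ []) ∷ (R 1F ⟶ X 1F ∷ [])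
       ∷ (R 2F ⟶ X 2F ∷ []) ∷ [])
    ∷ []
    )

search-Kind : Searchable Kind
search-Kind = search-⊎ (search-⊎ Fin.any? Fin.any?) (search-⊎ Fin.any? Fin.any?)

abstract
  -- Evaluation settles all 512 triples of kinds; `abstract` keeps this computation from being
  -- unfolded by later uses.
  clone-plan : ∀ kinds → ∃ (SymbolCovers kinds (X 0F) (X 1F) (X 2F))
  clone-plan kinds = Any.satisfied (covering kinds)
    where
    covering : ∀ kinds → Any (SymbolCovers kinds (X 0F) (X 1F) (X 2F)) clonePlans
    covering = toWitness {a? = for-all? (search-Vec search-Kind 3) λ kinds →
      any? (covers? kinds (X 0F) (X 1F) (X 2F)) clonePlans} tt

-- From symbols to the vertices of the graph

module _ {s t : ℕ} where

  private
    W = Fin (3 + s) ⊎ Fin (3 + t)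

  kind : W → Kind
  kind (inj₁ i) = Sum.map inj₁ (const (inj₁ 0F)) (splitAt 3 i)
  kind (inj₂ j) = Sum.map inj₂ (const (inj₂ 0F)) (splitAt 3 j)

  embed : Core → W
  embed = Sum.map (_↑ˡ s) (_↑ˡ t)

  kindLabel-kind : ∀ v → kindLabel (kind v) ≡ Sum.map clip clip v
  kindLabel-kind (inj₁ i) with splitAt 3 i
  ... | inj₁ _ = refl
  ... | inj₂ _ = refl
  kindLabel-kind (inj₂ j) with splitAt 3 j
  ... | inj₁ _ = refl
  ... | inj₂ _ = refl

  kind-embed : ∀ v → kind (embed v) ≡ inj₁ v
  kind-embed (inj₁ i) = cong (Sum.map inj₁ _) (Fin.splitAt-↑ˡ 3 i s)
  kind-embed (inj₂ j) = cong (Sum.map inj₂ _) (Fin.splitAt-↑ˡ 3 j t)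

  kind-core : ∀ v {w} → kind v ≡ inj₁ w → embed w ≡ v
  kind-core (inj₁ i) eq with splitAt 3 i in split
  kind-core (inj₁ i) refl | inj₁ _ = cong inj₁ (Fin.splitAt⁻¹-↑ˡ split)
  kind-core (inj₂ j) eq with splitAt 3 j in split
  kind-core (inj₂ j) refl | inj₁ _ = cong inj₂ (Fin.splitAt⁻¹-↑ˡ split)

  module _ (terminals : Vec W 3) (injective : Injective _≡_ _≡_ (Vec.lookup terminals)) where

    private
      kinds : Vec Kind 3
      kinds = Vec.map kind terminals

    vertex : Symbol → W
    vertex (inj₁ v) = embed v
    vertex (inj₂ i) = Vec.lookup terminals i

    vertex-code : ∀ u → vertex (symbolCode kinds u) ≡ vertex u
    vertex-code (inj₁ v) = refl
    vertex-code (inj₂ i) rewrite lookup-map i kind terminals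
      with kind (Vec.lookup terminals i) in eq
    ... | inj₁ _ = kind-core _ eq
    ... | inj₂ _ = refl

    -- Makes codes canonical on the core: a terminal that happens to be a core vertex gets the same
    -- code as that vertex itself.
    vertex-kind : ∀ u {w} → kind (vertex u) ≡ inj₁ w → symbolCode kinds u ≡ inj₁ w
    vertex-kind (inj₁ v) eq = cong inj₁ (Sum.inj₁-injective (trans (sym (kind-embed v)) eq))
    vertex-kind (inj₂ i) eq rewrite lookup-map i kind terminals | eq = refl

    symbolCode-faithful : ∀ {u v} →
      symbolCode kinds u ≡ symbolCode kinds v → vertex u ≡ vertex v
    symbolCode-faithful {u} {v} eq =
      trans (sym (vertex-code u)) (trans (cong vertex eq) (vertex-code v))

    -- If one symbol comes from the core, both codes are that core vertex; two terminal symbols that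
    -- denote the same vertex are equal since the terminals are distinct.
    symbolCode-complete : ∀ {u v} →
      vertex u ≡ vertex v → symbolCode kinds u ≡ symbolCode kinds v
    symbolCode-complete {inj₁ u} {v} eq =
      sym (vertex-kind v (trans (cong kind (sym eq)) (kind-embed u)))
    symbolCode-complete {u@(inj₂ _)} {inj₁ v} eq =
      vertex-kind u (trans (cong kind eq) (kind-embed v))
    symbolCode-complete {inj₂ i} {inj₂ j} eq = cong (symbolCode kinds ∘ inj₂) (injective eq)

    symbolLabel-vertex : ∀ u → symbolLabel kinds u ≡ Sum.map clip clip (vertex u)
    symbolLabel-vertex (inj₁ v) =
      trans (cong kindLabel (sym (kind-embed v))) (kindLabel-kind (embed v))
    symbolLabel-vertex (inj₂ i) =
      trans (cong kindLabel (lookup-map i kind terminals))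
        (kindLabel-kind (Vec.lookup terminals i))

colorable-6 : ∀ s t → Rainbow₃Colorable (K (3 + s) (3 + t)) 6
colorable-6 s t = sumColoring 6 clip clip , λ x y z x≢y x≢z y≢z →
  let terminals = x ∷ y ∷ z ∷ []
      injective : Injective _≡_ _≡_ (Vec.lookup terminals)
      injective = λ
        { {0F} {0F} _ → refl ; {1F} {1F} _ → refl ; {2F} {2F} _ → refl
        ; {0F} {1F} eq → contradiction eq x≢y ; {1F} {0F} eq → contradiction (sym eq) x≢y
        ; {0F} {2F} eq → contradiction eq x≢z ; {2F} {0F} eq → contradiction (sym eq) x≢z
        ; {1F} {2F} eq → contradiction eq y≢z ; {2F} {1F} eq → contradiction (sym eq) y≢z }
      kinds = Vec.map kind terminals
  in covers-sound kinds (vertex terminals injective)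
       (λ {u} {v} → symbolCode-faithful terminals injective {u} {v})
       (λ {u} {v} → symbolCode-complete terminals injective {u} {v})
       (symbolLabel-vertex terminals injective)
       (proj₂ (clone-plan kinds))

-- With `s` and `t` counting the vertices beyond three on each side, the bound drops below 6 only if
-- s + t ≤ 2. As s ≤ t, this leaves the four small cases.
colorable-bound : ∀ {s t} → s ≤ t → Rainbow₃Colorable (K (3 + s) (3 + t)) (6 ⊓ (s + (3 + t)))
colorable-bound {0} {0} _ = colorable-3-3
colorable-bound {0} {1} _ = colorable-3-4
colorable-bound {0} {2} _ = colorable-3-5
colorable-bound {0} {suc (suc (suc t))} _ = colorable-6 0 (3 + t)
colorable-bound {1} {1} _ = colorable-4-4
colorable-bound {1} {suc (suc t)} _ = colorable-6 1 (2 + t)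
colorable-bound {suc (suc s)} {suc (suc t)} _ =
  -- Here the minimum does not evaluate, because the variable `s` blocks the sum.
  subst (Rainbow₃Colorable (K (5 + s) (5 + t))) (sym (ℕ.m≤n⇒m⊓n≡m 6≤))
    (colorable-6 (2 + s) (2 + t))
  where
  6≤ : 6 ≤ 2 + s + (5 + t)
  6≤ = s≤s (s≤s (ℕ.≤-trans (ℕ.m≤m+n 4 (1 + t)) (ℕ.m≤n+m (5 + t) s)))
colorable-bound {1} {0} ()
colorable-bound {suc (suc _)} {1} (s≤s ())

-- The lower bound at s = t = 3

head-edge : ∀ {G : Graph} {H : Subgraph G} {u v xs} →
  u ≢ v → IsPath H u v xs → ∃ (Subgraph.Edge H u)
head-edge {xs = []} _ p with () ← IsPath.starts p
head-edge {xs = _ ∷ []} u≢v p with IsPath.starts p | IsPath.ends p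
... | refl | refl = contradiction refl u≢v
head-edge {xs = _ ∷ _ ∷ _} _ p with IsPath.starts p | IsPath.linked p
... | refl | e ∷ _ = _ , e

-- Sending each of three left vertices to the color of a tree edge at it is injective: equal colors
-- mean the same edge, and an edge has only one left end.
three-colors : ∀ s t k → Rainbow₃Colorable (K (3 + s) t) k → 3 ≤ k
three-colors s t k (c , rainbow₃)
  with T , tree , rainbow , x∈ , y∈ , z∈ ←
    rainbow₃ (inj₁ 0F) (inj₁ 1F) (inj₁ 2F) (λ ()) (λ ()) (λ ()) =
  Fin.injective⇒≤ {f = λ i → color (edge⇒~ (proj₂ (edge i)))} λ eq →
    left-ends (rainbow _ _ eq)
  where
  open Subgraph T
  open EdgeColoring c
  open IsTree tree

  terminal : Fin 3 → Fin (3 + s) ⊎ Fin t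
  terminal = inj₁ ∘ (_↑ˡ s)

  edge : ∀ i → ∃ (Edge (terminal i))
  edge 0F = head-edge (λ ()) (proj₂ (connected x∈ y∈))
  edge 1F = head-edge (λ ()) (proj₂ (connected y∈ x∈))
  edge 2F = head-edge (λ ()) (proj₂ (connected z∈ x∈))

  left-ends : ∀ {i j} →
    (terminal i ≡ terminal j × proj₁ (edge i) ≡ proj₁ (edge j))
      ⊎ (terminal i ≡ proj₁ (edge j) × proj₁ (edge i) ≡ terminal j) → i ≡ j
  left-ends (inj₁ (eq , _)) = Fin.↑ˡ-injective s _ _ (Sum.inj₁-injective eq)
  -- Were the two edges equal with ends exchanged, an edge would join two left vertices.
  left-ends {j = j} (inj₂ (eq , _))
    with () ← subst (BipartiteAdj (terminal j)) (sym eq) (edge⇒~ (proj₂ (edge j)))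

theorem3p1 : (∀ (s t : ℕ) → 3 ≤ s → s ≤ t →
    ∃[ r ] (IsRx₃ (K s t) r × r ≤ 6 ⊓ (s + t ∸ 3)))
    × (∃[ s ] ∃[ t ] (3 ≤ s × s ≤ t × IsRx₃ (K s t) (6 ⊓ (s + t ∸ 3))))
theorem3p1 =
  -- Matching exposes three successors on each side, after which `s + t ∸ 3` reduces to the form
  -- used in `colorable-bound`.
  (λ { s t (s≤s (s≤s (s≤s _))) (s≤s (s≤s (s≤s s≤t))) →
         rx₃-exists s t _ (colorable-bound s≤t) }) ,
  3 , 3 , ℕ.≤-refl , ℕ.≤-refl ,
  record { colorable = colorable-3-3 ; minimal = three-colors 0 3 }
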